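{- Let $G$ be a finite, connected game board in which every edge is marked with an arrow and there are no sinks and no sources. Then $G$ contains a cycle cell.
   Context: A board is a simple connected planar graph embedded in the plane, together with its bounded cells (bounded faces). An edge marked with an arrow is oriented in one of its two directions. A sink is a vertex all of whose incident edges are marked with arrows pointing toward it; a source is a vertex all of whose incident edges are marked with arrows pointing away from it. A cycle cell is a bounded cell all of whose boundary edges are marked with arrows all cycling in the same direction (all clockwise or all counterclockwise) around that cell. -}

module Defs where

open import Data.Bool.Base using (Bool; not)
open import Data.Fin.Base using (Fin)
open import Data.Maybe.Base using (Maybe; just)
open import Data.Nat.Base using (ℕ; _+_)
open import Data.Nat.GeneralisedArithmetic using (iterate)
open import Data.Product.Base using (_×_; _,_; ∃-syntax)
open import Data.Sum.Base using (_⊎_)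
open import Function.Base using (_∘_)
open import Function.Bundles using (_⇔_; _↔_; Inverse)
open import Relation.Binary.Construct.Closure.ReflexiveTransitive using (Star)
open import Relation.Binary.PropositionalEquality using (_≡_; _≢_)

-- On a finite set, forward iterates of a permutation already exhaust its orbits.
SameOrbit : {A : Set} → (A → A) → A → A → Set
SameOrbit f x y = ∃[ k ] iterate f x k ≡ y

-- The Boolean selects one of the two ends of an edge.  A dart (e , b) is the
-- edge e traversed starting from its end b.
record Graph : Set where
  field
    #V #E : ℕ
    end   : Fin #E → Bool → Fin #V

  Vertex Edge Dart : Set
  Vertex = Fin #V
  Edge   = Fin #E
  Dart   = Edge × Bool

  rev : Dart → Dart
  rev (e , b) = e , not b

  tail head : Dart → Vertex
  tail (e , b) = end e b
  head = tail ∘ rev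

  Adjacent : Vertex → Vertex → Set
  Adjacent u v = ∃[ d ] (tail d ≡ u × head d ≡ v)

  record IsSimple : Set where
    field
      loopless   : ∀ d → tail d ≢ head d
      noParallel : ∀ d d′ → tail d ≡ tail d′ → head d ≡ head d′ → d ≡ d′

  -- The empty graph is not connected.
  Connected : Set
  Connected = Vertex × (∀ u v → Star Adjacent u v)

-- An embedding of a connected graph in the plane, up to homeomorphism, as a
-- combinatorial map of genus 0 with a distinguished outer (unbounded) face.
record PlaneEmbedding (G : Graph) : Set where
  open Graph G
  field
    -- The next dart, clockwise, around the common tail.
    rotation   : Dart ↔ Dart
    aroundTail : ∀ d d′ → tail d ≡ tail d′ ⇔ SameOrbit (Inverse.to rotation) d d′

  -- Walk along a dart, then leave its head by the first dart clockwise from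
  -- the one just traversed: this follows the boundary of the face on the left.
  faceStep : Dart → Dart
  faceStep d = Inverse.to rotation (rev d)

  field
    #F          : ℕ
    -- The face on the left of a dart.
    leftFace    : Dart → Fin #F
    aroundFace  : ∀ d d′ → leftFace d ≡ leftFace d′ ⇔ SameOrbit faceStep d d′
    -- Only the face of the one-vertex graph has no boundary edge.
    hasBoundary : ∀ f → (∃[ d ] leftFace d ≡ f) ⊎ #E ≡ 0
    outer       : Fin #F
    -- Euler's formula V - E + F = 2: the surface is a sphere, and removing a
    -- point of the outer face gives the plane.
    euler       : #V + #F ≡ #E + 2

  Face : Set
  Face = Fin #F

record Board : Set where
  field
    graph     : Graph
    simple    : Graph.IsSimple graph
    connected : Graph.Connected graph
    embedding : PlaneEmbedding graph

  open Graph graph public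
  open PlaneEmbedding embedding public

  Bounded : Face → Set
  Bounded f = f ≢ outer

  -- An edge is unmarked (nothing), or carries an arrow starting from its end b
  -- (just b).
  Marking : Set
  Marking = Edge → Maybe Bool

  module _ (M : Marking) where

    Arrow : Dart → Set
    Arrow (e , b) = M e ≡ just b

    AllMarked : Set
    AllMarked = ∀ e → ∃[ b ] Arrow (e , b)

    Sink : Vertex → Set
    Sink v = ∀ d → head d ≡ v → Arrow d

    Source : Vertex → Set
    Source v = ∀ d → tail d ≡ v → Arrow d

    -- The darts with f on their left run counterclockwise around a bounded f,
    -- and their reverses run clockwise.  An edge with f on both sides occurs in
    -- both directions, so it excludes a cycle.
    CycleCell : Face → Set
    CycleCell f = Bounded f ×
      ((∀ d → leftFace d ≡ f → Arrow d) ⊎ (∀ d → leftFace d ≡ f → Arrow (rev d)))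

{-# OPTIONS --safe #-}

-- Call an arrow sign change between clockwise consecutive darts at a vertex a
-- turn of that vertex, and one between consecutive darts of a face boundary a
-- turn of that face.  Since reversing a dart flips its sign, every corner of
-- the embedding is a turn of its vertex or of its face, but not of both, and
-- there are 2E corners.  Signs change evenly often around a cycle, so without
-- sinks and sources every vertex has at least two turns, and so does every
-- bounded face which is not a cycle cell.  If there were no cycle cell, then
-- 2V + 2(F - 1) ≤ 2E, against Euler's formula.
module Submission where

open import Defs
open import Data.Bool.Base using (Bool; true; false; not; _xor_)
open import Data.Bool.Properties
  using (not-involutive; not-injective; not-¬; ¬-not; not-distribʳ-xor)
  renaming (_≟_ to _≟ᵇ_)
open import Data.Fin.Base using (Fin; zero; suc; punchIn)
open import Data.Fin.Properties
  using (_≟_; ∀-cons; injective⇒≤; punchIn-injective; punchInᵢ≢i; +↔⊎; *↔×; 2↔Bool)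
open import Data.Nat.Base using (zero; suc; _+_; _*_; _≤_; s≤s; s≤s⁻¹)
open import Data.Nat.GeneralisedArithmetic using (iterate)
open import Data.Nat.Properties using (*-cancelʳ-≤; +-suc; m+1+n≰m; module ≤-Reasoning)
open import Data.Product.Base using (_×_; _,_; proj₁; ∃-syntax)
open import Data.Product.Function.NonDependent.Propositional using (_×-↔_)
open import Data.Sum.Base using (_⊎_; inj₁; inj₂; swap)
open import Function.Base using (_∘_; _$_)
open import Function.Bundles using (_⇔_; _↔_; Inverse; Equivalence; Injection)
open import Function.Construct.Composition using (_↔-∘_)
open import Function.Construct.Identity using (↔-id)
open import Function.Construct.Symmetry using (↔-sym)
open import Function.Definitions using (Injective)
open import Function.Properties.Inverse using (↔⇒↣)
open import Relation.Binary.PropositionalEquality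
  using (_≡_; _≢_; refl; sym; trans; cong; module ≡-Reasoning)
open import Relation.Nullary.Decidable.Core using (yes; no)
open import Relation.Nullary.Negation.Core using (¬_; contradiction)

-- Constructive search: `Q` need not be the negation of `P`, so both outcomes carry usable evidence.
∃⊎∀-Fin : ∀ {n} {P Q : Fin n → Set} → (∀ i → P i ⊎ Q i) → (∃[ i ] P i) ⊎ (∀ i → Q i)
∃⊎∀-Fin {zero}  _ = inj₂ λ ()
∃⊎∀-Fin {suc _} r with r zero | ∃⊎∀-Fin (r ∘ suc)
... | inj₁ p | _            = inj₁ (zero , p)
... | inj₂ _ | inj₁ (i , p) = inj₁ (suc i , p)
... | inj₂ q | inj₂ qs      = inj₂ (∀-cons q qs)

∃⊎∀-Bool : {P Q : Bool → Set} → (∀ b → P b ⊎ Q b) → (∃[ b ] P b) ⊎ (∀ b → Q b)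
∃⊎∀-Bool r with r true | r false
... | inj₁ p | _      = inj₁ (true , p)
... | inj₂ _ | inj₁ p = inj₁ (false , p)
... | inj₂ q | inj₂ q′ = inj₂ λ where
  true  → q
  false → q′

∃⊎∀-× : ∀ {n} {P Q : Fin n × Bool → Set} →
  (∀ d → P d ⊎ Q d) → (∃[ d ] P d) ⊎ (∀ d → Q d)
∃⊎∀-× r with ∃⊎∀-Fin (λ e → ∃⊎∀-Bool (λ b → r (e , b)))
... | inj₁ (e , b , p) = inj₁ ((e , b) , p)
... | inj₂ q           = inj₂ λ (e , b) → q e b

-- Dropping a point o from Fin n, without exposing n as a successor.
avoiding : ∀ {n} (o : Fin n) →
  ∃[ m ] n ≡ suc m × ∃[ ι ] Injective {A = Fin m} {B = Fin n} _≡_ _≡_ ι × (∀ i → ι i ≢ o)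
avoiding {suc m} o = m , refl , punchIn o , punchIn-injective o _ _ , punchInᵢ≢i o

-- The `Bool` factors are the 2s of the count: two turns per vertex or face, two darts per edge.
2*-injective⇒≤ : ∀ {m n k} {φ : (Fin m ⊎ Fin n) × Bool → Fin k × Bool} →
  Injective _≡_ _≡_ φ → m + n ≤ k
2*-injective⇒≤ {m} {n} {k} {φ} φ-inj = *-cancelʳ-≤ (m + n) k 2 $ injective⇒≤ $
  Injection.injective (↔⇒↣ source) ∘ φ-inj ∘ Injection.injective (↔⇒↣ (↔-sym target))
  where
  pairs : ∀ l → Fin (l * 2) ↔ (Fin l × Bool)
  pairs l = (↔-id _ ×-↔ 2↔Bool) ↔-∘ *↔×
  source : Fin ((m + n) * 2) ↔ ((Fin m ⊎ Fin n) × Bool)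
  source = (+↔⊎ ×-↔ ↔-id _) ↔-∘ pairs (m + n)
  target : Fin (k * 2) ↔ (Fin k × Bool)
  target = pairs k

Attains : {A C : Set} → (A → C) → (A → Bool) → C → Bool → Set
Attains label s c b = ∃[ x ] label x ≡ c × s x ≡ b

-- Here `b` is the sign before the change, so having a turn for each `b` gives two distinct turns
-- without any counting.
Turn : {A C : Set} → (A → A) → (A → C) → (A → Bool) → C → Bool → Set
Turn f label s c b = ∃[ x ] label x ≡ c × s x ≡ b × s (f x) ≡ not b

attains? : ∀ {n k} (label : Fin n × Bool → Fin k) (s : Fin n × Bool → Bool) c b →
  Attains label s c b ⊎ (∀ d → label d ≡ c → s d ≡ not b)
attains? label s c b = ∃⊎∀-× decide
  where
  decide : ∀ d → (label d ≡ c × s d ≡ b) ⊎ (label d ≡ c → s d ≡ not b)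
  decide d with label d ≟ c | s d ≟ᵇ b
  ... | no ld≢c  | _        = inj₂ λ ld≡c → contradiction ld≡c ld≢c
  ... | yes _    | no sd≢b  = inj₂ λ _ → ¬-not sd≢b
  ... | yes ld≡c | yes sd≡b = inj₁ (ld≡c , sd≡b)

-- Discrete intermediate value: the first step that leaves sign `b` is the turn.
turn-along-orbit : {A : Set} (f : A → A) (s : A → Bool) → ∀ {b} k x →
  s x ≡ b → s (iterate f x k) ≡ not b →
  ∃[ y ] SameOrbit f x y × s y ≡ b × s (f y) ≡ not b
turn-along-orbit f s zero x sx end = contradiction end (not-¬ sx)
turn-along-orbit f s {b} (suc k) x sx end with s (f x) ≟ᵇ b
... | no sfx≢b = x , (0 , refl) , sx , ¬-not sfx≢b
... | yes sfx≡b with turn-along-orbit f s k (f x) sfx≡b end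
...   | y , (j , fx⇝y) , turn = y , (suc j , fx⇝y) , turn

-- An orbit can be followed forward from sign `b` to sign `not b` and also back again, so it
-- contains a change in each direction.
attains⇒turn : {A C : Set} {f : A → A} {label : A → C} {s : A → Bool} →
  (∀ x y → label x ≡ label y ⇔ SameOrbit f x y) →
  ∀ {c} → (∀ b → Attains label s c b) → ∀ b → Turn f label s c b
attains⇒turn {f = f} {s = s} orbit attains b
  with x , lx , sx ← attains b | y , ly , sy ← attains (not b)
  with k , refl ← Equivalence.to (orbit x y) (trans lx (sym ly))
  with z , x⇝z , turn ← turn-along-orbit f s k x sx sy
  = z , trans (sym (Equivalence.from (orbit x z) x⇝z)) lx , turn

module _ (B : Board) where
  open Board B

  rev-involutive : ∀ d → rev (rev d) ≡ d
  rev-involutive (e , b) = cong (e ,_) (not-involutive b)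

  rotate : Dart → Dart
  rotate = Inverse.to rotation

  module _ (sign : Dart → Bool) (sign-rev : ∀ d → sign (rev d) ≡ not (sign d)) where

    turns-bound : ∀ {m} (ι : Fin m → Face) → Injective _≡_ _≡_ ι →
      (∀ v b → Turn rotate tail sign v b) →
      (∀ i b → Turn faceStep leftFace sign (ι i) b) →
      #V + m ≤ #E
    turns-bound {m} ι ι-inj vturn fturn = 2*-injective⇒≤ corner-injective
      where
      -- A turn d of a face is, as a corner at a vertex, the one following rev d.
      corner : (Vertex ⊎ Fin m) × Bool → Dart
      corner (inj₁ v , b) = proj₁ (vturn v b)
      corner (inj₂ i , b) = rev (proj₁ (fturn i b))

      -- At a shared dart `d`, equal to `rev d′`, both turns have the same successor `rotate d`,
      -- whose sign forces `b` to equal `b′`; but `d` and `d′` have opposite signs.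
      disjoint : ∀ v i b b′ → corner (inj₁ v , b) ≢ corner (inj₂ i , b′)
      disjoint v i b b′ eq
        with d , _ , sd , srd ← vturn v b | d′ , _ , sd′ , srd′ ← fturn i b′
        with refl ← eq
        = not-¬ (trans (sym srd′) srd) (begin
            not b′          ≡⟨ cong not sd′ ⟨
            not (sign d′)   ≡⟨ sign-rev d′ ⟨
            sign (rev d′)   ≡⟨ sd ⟩
            b               ≡⟨ not-involutive b ⟨
            not (not b)     ∎)
        where open ≡-Reasoning

      -- A dart determines its tail, its left face and its sign, so the index of a turn can be read
      -- back from the dart.
      corner-injective : Injective _≡_ _≡_ corner
      corner-injective {inj₁ v , b} {inj₁ v′ , b′} eq
        with d , refl , refl , _ ← vturn v b | _ , refl , refl , _ ← vturn v′ b′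
        with refl ← eq = refl
      corner-injective {inj₁ v , b} {inj₂ i , b′} eq = contradiction eq (disjoint v i b b′)
      corner-injective {inj₂ i , b} {inj₁ v , b′} eq = contradiction (sym eq) (disjoint v i b′ b)
      corner-injective {inj₂ i , b} {inj₂ i′ , b′} eq
        with d , ld , refl , _ ← fturn i b | d′ , ld′ , refl , _ ← fturn i′ b′
        with refl ← trans (sym (rev-involutive d)) (trans (cong rev eq) (rev-involutive d′))
        with refl ← ι-inj (trans (sym ld) ld′) = refl

    turns-absurd : (∀ v b → Turn rotate tail sign v b) →
      ¬ (∀ f → Bounded f → ∀ b → Turn faceStep leftFace sign f b)
    turns-absurd vturn fturn
      with m , #F≡1+m , ι , ι-inj , ι≢outer ← avoiding outer
      -- As m = F - 1, Euler's formula makes V + m equal to E + 1, one above the bound. Both sides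
      -- carry an extra `suc` to avoid subtraction.
      = m+1+n≰m #E {0} (s≤s⁻¹ (begin
          suc (#E + 1)   ≡⟨ +-suc #E 1 ⟨
          #E + 2         ≡⟨ euler ⟨
          #V + #F        ≡⟨ cong (#V +_) #F≡1+m ⟩
          #V + suc m     ≡⟨ +-suc #V m ⟩
          suc (#V + m)   ≤⟨ s≤s (turns-bound ι ι-inj vturn λ i → fturn (ι i) (ι≢outer i)) ⟩
          suc #E         ∎))
      where open ≤-Reasoning

  module _ (M : Marking) (marked : AllMarked M) where

    -- The value is `true` exactly when the arrow runs along the dart: xor with `not b` tests
    -- equality with `b`.
    sign : Dart → Bool
    sign (e , b) = proj₁ (marked e) xor not b

    sign-rev : ∀ d → sign (rev d) ≡ not (sign d)
    sign-rev (e , b) = sym (not-distribʳ-xor (proj₁ (marked e)) (not b))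

    sign⇒Arrow : ∀ d → sign d ≡ true → Arrow M d
    sign⇒Arrow (e , b) sd with marked e
    sign⇒Arrow (e , true)  sd | true  , Me = Me
    sign⇒Arrow (e , false) sd | false , Me = Me

    sign-rev⇒Arrow : ∀ d → sign (rev d) ≡ false → Arrow M d
    sign-rev⇒Arrow d srd = sign⇒Arrow d (not-injective (trans (sym (sign-rev d)) srd))

    sign⇒Arrow-rev : ∀ d → sign d ≡ false → Arrow M (rev d)
    sign⇒Arrow-rev d sd = sign⇒Arrow (rev d) (trans (sign-rev d) (cong not sd))

    vertex-attains : ∀ v → ¬ Sink M v → ¬ Source M v → ∀ b → Attains tail sign v b
    vertex-attains v ¬sink ¬source b with attains? tail sign v b
    ... | inj₁ attained = attained
    vertex-attains v ¬sink ¬source true | inj₂ all-false =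
      -- Since `head d` unfolds to `tail (rev d)`, the darts into `v` are the reverses of those
      -- leaving it, and all of the latter oppose their arrows.
      contradiction (λ d hd → sign-rev⇒Arrow d (all-false (rev d) hd)) ¬sink
    vertex-attains v ¬sink ¬source false | inj₂ all-true =
      contradiction (λ d td → sign⇒Arrow d (all-true d td)) ¬source

    cycleCell⊎attains : ∀ f →
      CycleCell M f ⊎ (Bounded f → ∀ b → Attains leftFace sign f b)
    cycleCell⊎attains f with f ≟ outer | ∃⊎∀-Bool (swap ∘ attains? leftFace sign f)
    ... | yes f≡o | _ = inj₂ λ f≢o → contradiction f≡o f≢o
    ... | no _ | inj₂ attained = inj₂ λ _ → attained
    -- The Boolean found is the sign missing from the boundary: without `true` the cycle is
    -- clockwise, without `false` counterclockwise.
    ... | no f≢o | inj₁ (true , all-false) =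
      inj₁ (f≢o , inj₂ λ d ld → sign⇒Arrow-rev d (all-false d ld))
    ... | no f≢o | inj₁ (false , all-true) =
      inj₁ (f≢o , inj₁ λ d ld → sign⇒Arrow d (all-true d ld))

theorem6p1 : (B : Board) (M : Board.Marking B) → Board.AllMarked B M →
    (∀ v → ¬ Board.Sink B M v) → (∀ v → ¬ Board.Source B M v) →
    ∃[ f ] Board.CycleCell B M f
theorem6p1 B M marked ¬sink ¬source with ∃⊎∀-Fin (cycleCell⊎attains B M marked)
... | inj₁ cell = cell
... | inj₂ attained = contradiction
  (λ f bounded → attains⇒turn (Board.aroundFace B) (attained f bounded))
  (turns-absurd B (sign B M marked) (sign-rev B M marked) λ v →
    attains⇒turn (Board.aroundTail B) (vertex-attains B M marked v (¬sink v) (¬source v)))
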